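{- Let $G$ be a graph with $n$ vertices and $m$ edges, and let $k$ be an integer. Then $G$ has an $\alpha$-labeling with critical number $k$ if and only if $n\leqslant m+1$, $G$ is bipartite, and there is a bipartition of $\widehat{G}$ and an arrangement of the vertices of $\widehat{G}$ such that the corresponding biadjacency matrix $A$ is graceful and $A$ has $k+1$ rows. Likewise, $G$ has a complete $\alpha$-labeling with critical number $k$ if and only if $n=m+1$, $G$ is bipartite, and there is a bipartition of $\widehat{G}$ and an arrangement of its vertices such that the corresponding biadjacency matrix $A$ is completely graceful and has $k+1$ rows.
   Context: Graphs are finite, simple and undirected. For a graph $G=(V,E)$ with $m$ edges, a $\beta$-labeling (graceful labeling) is an injective $f:V\to\{0,\ldots,m\}$ such that the edge labels $|f(u)-f(v)|$, $uv\in E$, are distinct. An $\alpha$-labeling with critical number $k\in\{0,\ldots,m\}$ is a $\beta$-labeling $f$ such that for every edge $uv$ either $f(u)\le k<f(v)$ or $f(v)\le k<f(u)$; it is complete if $f$ is bijective. If $G$ has $n\le m+1$ vertices, $\widehat{G}$ is $G$ with $m+1-n$ isolated vertices added. For a bipartite graph with parts $X,Y$ (with the vertices of each part ordered), the biadjacency matrix is the $|X|\times|Y|$ $0$-$1$ matrix whose $(x,y)$ entry is $1$ iff $xy$ is an edge. For a $p\times q$ matrix the box-value of position $(i,j)$ is $p+j-i$; for $c=1,\ldots,p+q-1$ the positions with box-value $c$ form a diagonal. A $0$-$1$ matrix is graceful if every diagonal contains at most one $1$, and completely graceful if every diagonal contains exactly one $1$. -}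

module Defs where

open import Data.Fin using (Fin; toℕ; splitAt; _<?_)
open import Data.Fin.Patterns using (0F; 1F)
open import Data.Fin.Subset using (Subset; _∈_; ∁)
open import Data.Integer using (ℤ; +_) renaming (_≤_ to _≤ᶻ_; _<_ to _<ᶻ_)
open import Data.List using (List; length; filter; allFin; cartesianProduct)
open import Data.Nat using (ℕ; suc; _+_; _∸_; _≤_; ∣_-_∣)
open import Data.Product using (∃; ∃!; _×_; _,_)
open import Data.Sum using (_⊎_; inj₁; inj₂)
open import Data.Sum.Relation.Binary.Pointwise using (Pointwise; inj₁; ⊎-symmetric; ⊎-decidable)
open import Data.Bool using (if_then_else_)
open import Function using (_on_; _⇔_)
open import Function.Definitions using (Injective; Bijective)
open import Level using (0ℓ)
open import Relation.Binary using (Rel; Symmetric; Irreflexive; Decidable)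
open import Relation.Binary.Construct.Never using (Never)
open import Relation.Binary.PropositionalEquality using (_≡_; refl)
open import Relation.Nullary using (¬_; no; does)
open import Relation.Nullary.Decidable using (_×-dec_)

record Graph (n : ℕ) : Set₁ where
  field
    Adj        : Rel (Fin n) 0ℓ
    Adj-sym    : Symmetric Adj
    Adj-irrefl : Irreflexive _≡_ Adj
    adj?       : Decidable Adj

open Graph public

-- Each edge is listed once, as the pair of its ends in increasing order.
edges : ∀ {n} → Graph n → List (Fin n × Fin n)
edges {n} G =
  filter (λ (u , v) → (u <? v) ×-dec adj? G u v) (cartesianProduct (allFin n) (allFin n))

size : ∀ {n} → Graph n → ℕ
size G = length (edges G)

-- Disjoint union with the edgeless graph on j vertices.
addIsolated : ∀ {n} → Graph n → (j : ℕ) → Graph (n + j)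
addIsolated {n} G j = record
  { Adj        = Adj⁺ on splitAt n
  ; Adj-sym    = λ {u} {v} → sym⁺ {splitAt n u} {splitAt n v}
  ; Adj-irrefl = λ { {u} refl → irr (splitAt n u) }
  ; adj?       = λ u v → ⊎-decidable (adj? G) (λ _ _ → no λ ()) (splitAt n u) (splitAt n v)
  }
  where
  Adj⁺ : Rel (Fin n ⊎ Fin j) 0ℓ
  Adj⁺ = Pointwise (Adj G) Never

  sym⁺ : Symmetric Adj⁺
  sym⁺ = ⊎-symmetric (Adj-sym G) (λ ())

  irr : ∀ s → ¬ Adj⁺ s s
  irr (inj₁ _) (inj₁ e) = Adj-irrefl G refl e

-- The truncated subtraction is only meaningful for n ≤ size G + 1; otherwise nothing is added.
hat : ∀ {n} (G : Graph n) → Graph (n + (size G + 1 ∸ n))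
hat {n} G = addIsolated G (size G + 1 ∸ n)

Labeling : ∀ {n} → Graph n → Set
Labeling {n} G = Fin n → Fin (suc (size G))

record IsBetaLabeling {n} (G : Graph n) (f : Labeling G) : Set where
  field
    injective : Injective _≡_ _≡_ f
    -- Edges with equal labels coincide as unordered pairs.
    distinct  : ∀ {u v x y} → Adj G u v → Adj G x y →
                ∣ toℕ (f u) - toℕ (f v) ∣ ≡ ∣ toℕ (f x) - toℕ (f y) ∣ →
                (u ≡ x × v ≡ y) ⊎ (u ≡ y × v ≡ x)

record IsAlphaLabeling {n} (G : Graph n) (k : ℤ) (f : Labeling G) : Set where
  field
    isBeta   : IsBetaLabeling G f
    0≤k      : + 0 ≤ᶻ k
    k≤m      : k ≤ᶻ + size G
    critical : ∀ {u v} → Adj G u v →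
               (+ toℕ (f u) ≤ᶻ k × k <ᶻ + toℕ (f v)) ⊎ (+ toℕ (f v) ≤ᶻ k × k <ᶻ + toℕ (f u))

record IsCompleteAlphaLabeling {n} (G : Graph n) (k : ℤ) (f : Labeling G) : Set where
  field
    isAlpha   : IsAlphaLabeling G k f
    bijective : Bijective _≡_ _≡_ f

HasAlphaLabeling : ∀ {n} → Graph n → ℤ → Set
HasAlphaLabeling G k = ∃ (IsAlphaLabeling G k)

HasCompleteAlphaLabeling : ∀ {n} → Graph n → ℤ → Set
HasCompleteAlphaLabeling G k = ∃ (IsCompleteAlphaLabeling G k)

-- Either part may be empty.
record Bipartition {n} (G : Graph n) : Set where
  field
    X : Subset n

  Y : Subset n
  Y = ∁ X

  field
    crossing : ∀ {u v} → Adj G u v → (u ∈ X × v ∈ Y) ⊎ (u ∈ Y × v ∈ X)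

Bipartite : ∀ {n} → Graph n → Set
Bipartite = Bipartition

-- A list of the elements of S without repetition, so that p = ∣ S ∣.
record Ordering {n} (S : Subset n) (p : ℕ) : Set where
  field
    at         : Fin p → Fin n
    injective  : Injective _≡_ _≡_ at
    enumerates : ∀ v → v ∈ S ⇔ ∃ λ i → at i ≡ v

-- A matrix is required to have at least one row, but may have no columns. Zero columns are
-- needed for the one-vertex graph (critical number 0, matrix of size 1 × 0). With zero rows, the
-- 0 × 1 matrix of that graph would be vacuously graceful with k = -1, which is not a
-- critical number.
record Arrangement {n} {G : Graph n} (B : Bipartition G) : Set where
  open Bipartition B
  field
    rows     : ℕ
    cols     : ℕ
    rows≥1   : 1 ≤ rows
    rowOrder : Ordering X rows
    colOrder : Ordering Y cols

Matrix01 : ℕ → ℕ → Set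
Matrix01 p q = Fin p → Fin q → Fin 2

biadjacency : ∀ {n} {G : Graph n} {B : Bipartition G} (a : Arrangement B) →
              Matrix01 (Arrangement.rows a) (Arrangement.cols a)
biadjacency {G = G} a i j =
  if does (adj? G (Ordering.at rowOrder i) (Ordering.at colOrder j)) then 1F else 0F
  where open Arrangement a

-- Rows and columns are numbered from 1; the subtraction never truncates.
boxValue : ∀ {p q} → Fin p → Fin q → ℕ
boxValue {p} i j = (p + suc (toℕ j)) ∸ suc (toℕ i)

OneOnDiagonal : ∀ {p q} → Matrix01 p q → ℕ → Fin p × Fin q → Set
OneOnDiagonal A c (i , j) = boxValue i j ≡ c × A i j ≡ 1F

Graceful : ∀ {p q} → Matrix01 p q → Set
Graceful {p} {q} A = ∀ c → 1 ≤ c → c ≤ p + q ∸ 1 →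
  ∀ s t → OneOnDiagonal A c s → OneOnDiagonal A c t → s ≡ t

CompletelyGraceful : ∀ {p q} → Matrix01 p q → Set
CompletelyGraceful {p} {q} A = ∀ c → 1 ≤ c → c ≤ p + q ∸ 1 → ∃! _≡_ (OneOnDiagonal A c)

{-# OPTIONS --safe #-}

-- Label row i with i and column j with p + j (indices from 0). Then the box-value of a position is
-- the difference of the labels of its row and its column, so a diagonal with at most one 1 is a
-- difference attained by at most one edge. Sorting the vertices of the hat graph by an
-- α-labeling, extended to a bijection, inverts this with p = k + 1. As there are m edges and m
-- possible nonzero differences, all differences then occur, so that the matrix is even completely
-- graceful, and completeness of the labeling only amounts to n = m + 1.
module Submission where

open import Defs
open import Data.Bool using (Bool; true)
open import Data.Bool.Properties using (T-≡)
import Data.Fin as Fin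
open import Data.Fin using (Fin; zero; suc; toℕ; fromℕ<; cast; join; splitAt; punchIn; punchOut; _↑ˡ_; _↑ʳ_; reduce≥)
open import Data.Fin.Patterns using (1F)
open import Data.Fin.Permutation using (↔⇒≡)
open import Data.Fin.Properties
  using (toℕ-injective; toℕ-↑ˡ; toℕ-↑ʳ; toℕ-cast; toℕ-fromℕ<; toℕ<n; toℕ≤pred[n]; ↑ˡ-injective; any?; _≟_;
         splitAt-↑ˡ; splitAt⁻¹-↑ˡ; splitAt⁻¹-↑ʳ; splitAt-≥; join-splitAt; splitAt-join; suc-injective;
         punchInᵢ≢i; punchIn-injective; punchIn-punchOut; punchOut-injective; injective⇒≤; +↔⊎)
open import Data.Fin.Subset using (Subset; _∈_; ∁)
open import Data.Fin.Subset.Properties using (_∈?_; x∈∁p⇒x∉p; x∉p⇒x∈∁p)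
open import Data.Integer using (ℤ; +_; -[1+_]; +≤+; +<+) renaming (_+_ to _+ᶻ_)
import Data.Integer as ℤ
import Data.Integer.Properties as ℤ
open import Data.List using (List; lookup; allFin; cartesianProduct)
open import Data.List.Membership.Propositional.Properties using (∈-lookup; ∈-filter⁻)
open import Data.List.Relation.Unary.AllPairs using (_∷_)
open import Data.List.Relation.Unary.Unique.Propositional using (Unique)
open import Data.List.Relation.Unary.Unique.Propositional.Properties using (allFin⁺; cartesianProduct⁺; filter⁺)
import Data.List.Relation.Unary.All as All
open import Data.Nat using (ℕ; zero; suc; _+_; _∸_; _≤_; _<_; _<ᵇ_; z≤n; s≤s; s≤s⁻¹; ∣_-_∣)
open import Data.Nat.Properties
  using (≤-refl; ≤-reflexive; ≤-trans; ≤-<-trans; <-asym; <⇒≤; <⇒≢; ≮⇒≥; ≤⇒≯; <ᵇ⇒<; <⇒<ᵇ; 1+n≰n; ⊔-lub;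
         +-comm; +-suc; +-cancelˡ-≡; +-monoʳ-≤; m≤m+n; m<m+n; m+[n∸m]≡n; m<n⇒0<n∸m; ∸-mono;
         m≤n⇒∣m-n∣≡n∸m; ∣m-n∣≡0⇒m≡n; ∣-∣-comm; ∣m-n∣≤m⊔n)
open import Data.Product using (Σ-syntax; ∃; ∃₂; _×_; _,_; proj₁; proj₂)
open import Data.Sum using (_⊎_; inj₁; inj₂; [_,_]′)
import Data.Sum as Sum
open import Data.Sum.Relation.Binary.Pointwise using (Pointwise; inj₁)
open import Data.Vec using (tabulate)
open import Data.Vec.Properties using (lookup∘tabulate; []=⇒lookup; lookup⇒[]=)
open import Function using (_⇔_; _↔_; _∘_; mk⇔; mk⤖; Equivalence; Injection; Inverse)
open import Function.Construct.Composition using (_↔-∘_)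
open import Function.Construct.Symmetry using (↔-sym)
open import Function.Consequences.Propositional using (strictlySurjective⇒surjective)
open import Function.Definitions using (Injective; StrictlySurjective; Bijective)
open import Function.Properties.Bijection using (⤖⇒↔)
open import Function.Properties.Inverse using (↔⇒↣)
open import Relation.Binary.Construct.Never using (Never)
open import Relation.Binary.PropositionalEquality
  using (_≡_; _≢_; refl; sym; trans; cong; cong₂; subst; subst₂; module ≡-Reasoning)
open import Relation.Nullary using (yes; no; contradiction)
open import Relation.Nullary.Decidable using (dec-true; _×-dec_)

private
  variable
    n N M : ℕ

-- Injections between finite sets

-- If `y` were missed, punching it out of the codomain would leave an injection of `Fin n` into a
-- set of `M - 1` elements, against `M ≤ n`.
injective⇒surjective : {f : Fin n → Fin M} → Injective _≡_ _≡_ f → M ≤ n → StrictlySurjective _≡_ f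
injective⇒surjective {M = suc _} {f} f-inj M≤n y with any? (λ x → f x ≟ y)
... | yes hit = hit
... | no miss = contradiction (≤-trans M≤n (injective⇒≤ avoid-injective)) 1+n≰n
  where
  y≢f : ∀ x → y ≢ f x
  y≢f x eq = miss (x , sym eq)

  avoid-injective : Injective _≡_ _≡_ (λ x → punchOut (y≢f x))
  avoid-injective eq = f-inj (punchOut-injective (y≢f _) (y≢f _) eq)

injective⇒bijective : {f : Fin n → Fin M} → Injective _≡_ _≡_ f → M ≤ n → Bijective _≡_ _≡_ f
injective⇒bijective f-inj M≤n = f-inj , strictlySurjective⇒surjective (injective⇒surjective f-inj M≤n)

complement : ∀ j (f : Fin n → Fin M) → Injective _≡_ _≡_ f → n + j ≡ M →
             Σ[ h ∈ (Fin j → Fin M) ] (Injective _≡_ _≡_ h × (∀ i k → f i ≢ h k))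
complement {zero}  j f f-inj refl = (λ k → k) , (λ eq → eq) , λ ()
complement {suc n} j f f-inj refl = h , h-inj , disjoint
  where
  f₀≢ : ∀ i → f zero ≢ f (suc i)
  f₀≢ i eq with () ← f-inj eq

  rest = complement j (λ i → punchOut (f₀≢ i))
           (λ eq → suc-injective (f-inj (punchOut-injective (f₀≢ _) (f₀≢ _) eq))) refl

  h : Fin j → Fin (suc n + j)
  h = punchIn (f zero) ∘ proj₁ rest

  h-inj : Injective _≡_ _≡_ h
  h-inj eq = proj₁ (proj₂ rest) (punchIn-injective (f zero) _ _ eq)

  disjoint : ∀ i k → f i ≢ h k
  disjoint zero    k eq = punchInᵢ≢i (f zero) _ (sym eq)
  disjoint (suc i) k eq = proj₂ (proj₂ rest) i k
    (punchIn-injective (f zero) _ _ (trans (punchIn-punchOut (f₀≢ i)) eq))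

extend : ∀ j (f : Fin n → Fin M) → Injective _≡_ _≡_ f → n + j ≡ M →
         Σ[ π ∈ (Fin (n + j) ↔ Fin M) ] (∀ i → Inverse.to π (i ↑ˡ j) ≡ f i)
extend {n} {M} j f f-inj n+j≡M =
  ⤖⇒↔ (mk⤖ (injective⇒bijective g-inj (≤-reflexive (sym n+j≡M)))) ,
  λ i → cong [ f , h ]′ (splitAt-↑ˡ n i j)
  where
  comp = complement j f f-inj n+j≡M
  h = proj₁ comp

  [f,h]-inj : Injective _≡_ _≡_ [ f , h ]′
  [f,h]-inj {inj₁ x} {inj₁ y} eq = cong inj₁ (f-inj eq)
  [f,h]-inj {inj₁ x} {inj₂ y} eq = contradiction eq (proj₂ (proj₂ comp) x y)
  [f,h]-inj {inj₂ x} {inj₁ y} eq = contradiction (sym eq) (proj₂ (proj₂ comp) y x)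
  [f,h]-inj {inj₂ x} {inj₂ y} eq = cong inj₂ (proj₁ (proj₂ comp) eq)

  g-inj : Injective _≡_ _≡_ ([ f , h ]′ ∘ splitAt n)
  g-inj {x} {y} eq = begin
    x                        ≡⟨ join-splitAt n j x ⟨
    join n j (splitAt n x)   ≡⟨ cong (join n j) ([f,h]-inj {splitAt n x} {splitAt n y} eq) ⟩
    join n j (splitAt n y)   ≡⟨ join-splitAt n j y ⟩
    y                        ∎
    where open ≡-Reasoning

lookup-injective : ∀ {A : Set} {xs : List A} → Unique xs → Injective _≡_ _≡_ (lookup xs)
lookup-injective (x∉xs ∷ _)    {zero}  {zero}  eq = refl
lookup-injective (x∉xs ∷ _)    {zero}  {suc j} eq = contradiction eq (All.lookup x∉xs (∈-lookup j))
lookup-injective (x∉xs ∷ _)    {suc i} {zero}  eq = contradiction (sym eq) (All.lookup x∉xs (∈-lookup i))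
lookup-injective (_ ∷ xs-uniq) {suc i} {suc j} eq = cong suc (lookup-injective xs-uniq eq)

-- Vertex labels with values in ℕ

SameEdge : (u v x y : Fin N) → Set
SameEdge u v x y = (u ≡ x × v ≡ y) ⊎ (u ≡ y × v ≡ x)

-- Labels are taken in ℕ so that one notion serves both labelings of `G`, with values in
-- `Fin (suc m)`, and numberings of the hat graph, with values in `Fin (rows + cols)`.
DistinctDiffs : Graph N → (Fin N → ℕ) → Set
DistinctDiffs H ℓ = ∀ {u v x y} → Adj H u v → Adj H x y →
  ∣ ℓ u - ℓ v ∣ ≡ ∣ ℓ x - ℓ y ∣ → SameEdge u v x y

Attains : Graph N → (Fin N → ℕ) → ℕ → Set
Attains H ℓ m = ∀ c → 1 ≤ c → c ≤ m → ∃₂ λ u v → Adj H u v × ∣ ℓ u - ℓ v ∣ ≡ c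

-- The critical condition with p = k + 1, the number of rows: `ℓ u ≤ k < ℓ v` reads `ℓ u < p ≤ ℓ v`.
Separates : Graph N → (Fin N → ℕ) → ℕ → Set
Separates H ℓ p = ∀ {u v} → Adj H u v → (ℓ u < p × p ≤ ℓ v) ⊎ (ℓ v < p × p ≤ ℓ u)

-- Edge labels of a graceful labeling

module _ (G : Graph n) {f : Labeling G} (β : IsBetaLabeling G f) where
  open IsBetaLabeling β

  private
    m = size G

    end₁ end₂ : Fin m → Fin n
    end₁ = proj₁ ∘ lookup (edges G)
    end₂ = proj₂ ∘ lookup (edges G)

    end₁<end₂×adj : ∀ e → toℕ (end₁ e) < toℕ (end₂ e) × Adj G (end₁ e) (end₂ e)
    end₁<end₂×adj e =
      proj₂ (∈-filter⁻ (λ (u , v) → (u Fin.<? v) ×-dec adj? G u v)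
                       {xs = cartesianProduct (allFin n) (allFin n)} (∈-lookup {xs = edges G} e))

    ends-injective : ∀ {e e′} → end₁ e ≡ end₁ e′ → end₂ e ≡ end₂ e′ → e ≡ e′
    ends-injective eq₁ eq₂ =
      lookup-injective (filter⁺ (λ (u , v) → (u Fin.<? v) ×-dec adj? G u v)
                                (cartesianProduct⁺ (allFin⁺ n) (allFin⁺ n)))
                       (cong₂ _,_ eq₁ eq₂)

    diff : Fin m → ℕ
    diff e = ∣ toℕ (f (end₁ e)) - toℕ (f (end₂ e)) ∣

    diff-injective : Injective _≡_ _≡_ diff
    diff-injective {e} {e′} eq
      with distinct (proj₂ (end₁<end₂×adj e)) (proj₂ (end₁<end₂×adj e′)) eq
    ... | inj₁ (eq₁ , eq₂) = ends-injective eq₁ eq₂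
    -- The list holds every edge with its smaller end first, so no two entries are reversals of each
    -- other.
    ... | inj₂ (eq₁ , eq₂) =
      contradiction (proj₁ (end₁<end₂×adj e′))
        (<-asym (subst₂ (λ u v → toℕ u < toℕ v) eq₁ eq₂ (proj₁ (end₁<end₂×adj e))))

    diff≢0 : ∀ e → diff e ≢ 0
    diff≢0 e eq = <⇒≢ (proj₁ (end₁<end₂×adj e))
                      (cong toℕ (injective (toℕ-injective (∣m-n∣≡0⇒m≡n eq))))

    diff≤m : ∀ e → diff e ≤ m
    diff≤m e = ≤-trans (∣m-n∣≤m⊔n (toℕ (f (end₁ e))) _)
                       (⊔-lub (toℕ≤pred[n] (f (end₁ e))) (toℕ≤pred[n] (f (end₂ e))))

    -- An extra argument hits 0, which no edge label is, so that injectivity yields surjectivity.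
    diff₀ : Fin (suc m) → Fin (suc m)
    diff₀ zero    = zero
    diff₀ (suc e) = fromℕ< (s≤s (diff≤m e))

    toℕ-diff₀ : ∀ e → toℕ (diff₀ (suc e)) ≡ diff e
    toℕ-diff₀ e = toℕ-fromℕ< (s≤s (diff≤m e))

    diff₀-injective : Injective _≡_ _≡_ diff₀
    diff₀-injective {zero}  {zero}   _  = refl
    diff₀-injective {zero}  {suc e}  eq =
      contradiction (trans (sym (toℕ-diff₀ e)) (cong toℕ (sym eq))) (diff≢0 e)
    diff₀-injective {suc e} {zero}   eq =
      contradiction (trans (sym (toℕ-diff₀ e)) (cong toℕ eq)) (diff≢0 e)
    diff₀-injective {suc e} {suc e′} eq =
      cong suc (diff-injective (trans (sym (toℕ-diff₀ e)) (trans (cong toℕ eq) (toℕ-diff₀ e′))))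

  attains-all : Attains G (toℕ ∘ f) m
  attains-all c 1≤c c≤m with injective⇒surjective diff₀-injective ≤-refl (fromℕ< (s≤s c≤m))
  -- The extra argument has value 0, whereas c is positive.
  ... | zero  , eq = contradiction (trans (cong toℕ eq) (toℕ-fromℕ< (s≤s c≤m))) (<⇒≢ 1≤c)
  ... | suc e , eq = end₁ e , end₂ e , proj₂ (end₁<end₂×adj e) ,
    trans (sym (toℕ-diff₀ e)) (trans (cong toℕ eq) (toℕ-fromℕ< (s≤s c≤m)))

-- Adding isolated vertices

module _ (G : Graph n) (j : ℕ) where

  isolated-adj⁺ : ∀ {u v} → Adj G u v → Adj (addIsolated G j) (u ↑ˡ j) (v ↑ˡ j)
  isolated-adj⁺ {u} {v} uv =
    subst₂ (Pointwise (Adj G) Never) (sym (splitAt-↑ˡ n u j)) (sym (splitAt-↑ˡ n v j)) (inj₁ uv)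

  isolated-adj⁻ : ∀ {u v} → Adj (addIsolated G j) u v →
                  ∃₂ λ u′ v′ → u′ ↑ˡ j ≡ u × v′ ↑ˡ j ≡ v × Adj G u′ v′
  isolated-adj⁻ {u} {v} uv with splitAt n u in equ | splitAt n v in eqv | uv
  -- No other case arises: `Pointwise` relates only elements of the same side, and `Never` is empty
  -- on the added side.
  ... | inj₁ u′ | inj₁ v′ | inj₁ u′v′ = u′ , v′ , splitAt⁻¹-↑ˡ equ , splitAt⁻¹-↑ˡ eqv , u′v′

  module _ (ℓ̂ : Fin (n + j) → ℕ) (ℓ : Fin n → ℕ) (ℓ̂≡ℓ : ∀ u → ℓ̂ (u ↑ˡ j) ≡ ℓ u) where

    private
      diff≡ : ∀ u v → ∣ ℓ̂ (u ↑ˡ j) - ℓ̂ (v ↑ˡ j) ∣ ≡ ∣ ℓ u - ℓ v ∣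
      diff≡ u v = cong₂ ∣_-_∣ (ℓ̂≡ℓ u) (ℓ̂≡ℓ v)

    -- Each of the transferred conditions speaks of the ends of edges, and every edge of the
    -- extended graph lies in the image of `_↑ˡ j`, where `ℓ̂` agrees with `ℓ`.
    isolated-distinct⁺ : DistinctDiffs G ℓ → DistinctDiffs (addIsolated G j) ℓ̂
    isolated-distinct⁺ distinct uv xy eq with isolated-adj⁻ uv | isolated-adj⁻ xy
    ... | u , v , refl , refl , uv′ | x , y , refl , refl , xy′ =
      Sum.map (λ (p , q) → cong (_↑ˡ j) p , cong (_↑ˡ j) q)
              (λ (p , q) → cong (_↑ˡ j) p , cong (_↑ˡ j) q)
              (distinct uv′ xy′ (trans (sym (diff≡ u v)) (trans eq (diff≡ x y))))

    isolated-distinct⁻ : DistinctDiffs (addIsolated G j) ℓ̂ → DistinctDiffs G ℓ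
    isolated-distinct⁻ distinct {u} {v} {x} {y} uv xy eq =
      Sum.map (λ (p , q) → ↑ˡ-injective j _ _ p , ↑ˡ-injective j _ _ q)
              (λ (p , q) → ↑ˡ-injective j _ _ p , ↑ˡ-injective j _ _ q)
              (distinct (isolated-adj⁺ uv) (isolated-adj⁺ xy)
                (trans (diff≡ u v) (trans eq (sym (diff≡ x y)))))

    isolated-attains : ∀ {m} → Attains G ℓ m → Attains (addIsolated G j) ℓ̂ m
    isolated-attains attains c 1≤c c≤m =
      let u , v , uv , eq = attains c 1≤c c≤m
      in u ↑ˡ j , v ↑ˡ j , isolated-adj⁺ uv , trans (diff≡ u v) eq

    isolated-separates⁺ : ∀ {p} → Separates G ℓ p → Separates (addIsolated G j) ℓ̂ p
    isolated-separates⁺ separates uv with isolated-adj⁻ uv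
    ... | u , v , refl , refl , uv′ rewrite ℓ̂≡ℓ u | ℓ̂≡ℓ v = separates uv′

    isolated-separates⁻ : ∀ {p} → Separates (addIsolated G j) ℓ̂ p → Separates G ℓ p
    isolated-separates⁻ separates {u} {v} uv with separates (isolated-adj⁺ uv)
    ... | sep rewrite ℓ̂≡ℓ u | ℓ̂≡ℓ v = sep

-- Matrices

-- Together with the upper bound below, this places every position on one of the diagonals over
-- which `Graceful` quantifies.
boxValue≥1 : ∀ {p q} (i : Fin p) (j : Fin q) → 1 ≤ boxValue i j
boxValue≥1 {p} i j = m<n⇒0<n∸m (≤-<-trans (toℕ<n i) (m<m+n p (s≤s z≤n)))

boxValue≤p+q∸1 : ∀ {p q} (i : Fin p) (j : Fin q) → boxValue i j ≤ p + q ∸ 1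
boxValue≤p+q∸1 {p} i j = ∸-mono (+-monoʳ-≤ p (toℕ<n j)) (s≤s (z≤n {toℕ i}))

-- The two shifts by one cancel, and `i < p ≤ p + j` makes the subtraction exact.
boxValue≡∣-∣ : ∀ {p q} (i : Fin p) (j : Fin q) → boxValue i j ≡ ∣ toℕ i - (p + toℕ j) ∣
boxValue≡∣-∣ {p} i j = begin
  (p + suc (toℕ j)) ∸ suc (toℕ i)  ≡⟨ cong (_∸ suc (toℕ i)) (+-suc p (toℕ j)) ⟩
  (p + toℕ j) ∸ toℕ i              ≡⟨ m≤n⇒∣m-n∣≡n∸m (≤-trans (<⇒≤ (toℕ<n i)) (m≤m+n p _)) ⟨
  ∣ toℕ i - (p + toℕ j) ∣          ∎
  where open ≡-Reasoning

complete⇒graceful : ∀ {p q} {A : Matrix01 p q} → CompletelyGraceful A → Graceful A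
complete⇒graceful complete c 1≤c c≤ s t ones onet with complete c 1≤c c≤
... | _ , _ , unique = trans (sym (unique ones)) (unique onet)

-- Arrangements

module _ {H : Graph N} {B : Bipartition H} (a : Arrangement B) where
  open Bipartition B
  open Arrangement a

  row : Fin rows → Fin N
  row = Ordering.at rowOrder

  col : Fin cols → Fin N
  col = Ordering.at colOrder

  row∈X : ∀ i → row i ∈ X
  row∈X i = Equivalence.from (Ordering.enumerates rowOrder (row i)) (i , refl)

  col∈Y : ∀ j → col j ∈ Y
  col∈Y j = Equivalence.from (Ordering.enumerates colOrder (col j)) (j , refl)

  row≢col : ∀ {i j} → row i ≢ col j
  row≢col {i} {j} eq = x∈∁p⇒x∉p (col∈Y j) (subst (_∈ X) eq (row∈X i))

  -- `X` and its complement partition the vertices, so listing the rows and then the columns meets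
  -- every vertex exactly once. The numbering is the inverse of this list.
  numbering : Fin N ↔ Fin (rows + cols)
  numbering = ↔-sym (⤖⇒↔ (mk⤖ (vertex-injective , strictlySurjective⇒surjective vertex-surjective)) ↔-∘ +↔⊎)
    where
    vertex-injective : Injective _≡_ _≡_ [ row , col ]′
    vertex-injective {inj₁ i} {inj₁ i′} eq = cong inj₁ (Ordering.injective rowOrder eq)
    vertex-injective {inj₁ i} {inj₂ j}  eq = contradiction eq row≢col
    vertex-injective {inj₂ j} {inj₁ i}  eq = contradiction (sym eq) row≢col
    vertex-injective {inj₂ j} {inj₂ j′} eq = cong inj₂ (Ordering.injective colOrder eq)

    vertex-surjective : StrictlySurjective _≡_ [ row , col ]′
    vertex-surjective v with v ∈? X
    ... | yes v∈X = let i , eq = Equivalence.to (Ordering.enumerates rowOrder v) v∈X in inj₁ i , eq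
    ... | no  v∉X = let j , eq = Equivalence.to (Ordering.enumerates colOrder v) (x∉p⇒x∈∁p v∉X) in inj₂ j , eq

  -- A property rather than a fixed labeling, since it is met by `numbering` when a matrix is given
  -- and by the bijection behind `sorted` when a labeling is given.
  record Follows (ℓ : Fin N → ℕ) : Set where
    field
      on-row : ∀ i → ℓ (row i) ≡ toℕ i
      on-col : ∀ j → ℓ (col j) ≡ rows + toℕ j

  numbering-follows : Follows (toℕ ∘ Inverse.to numbering)
  numbering-follows = record
    { on-row = λ i → trans (cong toℕ (number (inj₁ i))) (toℕ-↑ˡ i cols)
    ; on-col = λ j → trans (cong toℕ (number (inj₂ j))) (toℕ-↑ʳ rows j)
    }
    where
    number : ∀ s → Inverse.to numbering ([ row , col ]′ s) ≡ join rows cols s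
    -- The inverse of the numbering, evaluated at `join rows cols s`, is the vertex of `splitAt` of
    -- that `join`, which is the vertex of `s`.
    number s = Inverse.inverseˡ numbering (sym (cong [ row , col ]′ (splitAt-join rows cols s)))

  -- Edges as entries of the biadjacency matrix

  one⇒adj : ∀ {i j} → biadjacency a i j ≡ 1F → Adj H (row i) (col j)
  one⇒adj {i} {j} one with adj? H (row i) (col j)
  ... | yes ij = ij

  adj⇒one : ∀ {i j} → Adj H (row i) (col j) → biadjacency a i j ≡ 1F
  adj⇒one {i} {j} ij rewrite dec-true (adj? H (row i) (col j)) ij = refl

  -- The orientation stays open, because either end of the edge may be the row vertex.
  Entry : Fin N → Fin N → Set
  Entry u v = ∃₂ λ i j → biadjacency a i j ≡ 1F × SameEdge u v (row i) (col j)

  adj⇒entry : ∀ {u v} → Adj H u v → Entry u v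
  adj⇒entry {u} {v} uv with crossing uv
  ... | inj₁ (u∈X , v∈Y)
    with i , refl ← Equivalence.to (Ordering.enumerates rowOrder u) u∈X
       | j , refl ← Equivalence.to (Ordering.enumerates colOrder v) v∈Y
    = i , j , adj⇒one uv , inj₁ (refl , refl)
  ... | inj₂ (u∈Y , v∈X)
    with i , refl ← Equivalence.to (Ordering.enumerates rowOrder v) v∈X
       | j , refl ← Equivalence.to (Ordering.enumerates colOrder u) u∈Y
    = i , j , adj⇒one (Adj-sym H uv) , inj₂ (refl , refl)

  -- Gracefulness and distinct differences

  module _ {ℓ : Fin N → ℕ} (follows : Follows ℓ) where
    open Follows follows

    boxValue≡diff : ∀ i j → boxValue i j ≡ ∣ ℓ (row i) - ℓ (col j) ∣
    boxValue≡diff i j = trans (boxValue≡∣-∣ i j) (cong₂ ∣_-_∣ (sym (on-row i)) (sym (on-col j)))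

    boxValue≡diff′ : ∀ {u v i j} → SameEdge u v (row i) (col j) → boxValue i j ≡ ∣ ℓ u - ℓ v ∣
    boxValue≡diff′ (inj₁ (refl , refl)) = boxValue≡diff _ _
    boxValue≡diff′ (inj₂ (refl , refl)) = trans (boxValue≡diff _ _) (∣-∣-comm (ℓ (row _)) _)

    follows⇒separates : Separates H ℓ rows
    follows⇒separates uv with adj⇒entry uv
    ... | i , j , _ , e = orient e
      where
      row<rows : ℓ (row i) < rows
      row<rows = subst (_< rows) (sym (on-row i)) (toℕ<n i)

      rows≤col : rows ≤ ℓ (col j)
      rows≤col = subst (rows ≤_) (sym (on-col j)) (m≤m+n rows _)

      orient : ∀ {u v} → SameEdge u v (row i) (col j) → (ℓ u < rows × rows ≤ ℓ v) ⊎ (ℓ v < rows × rows ≤ ℓ u)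
      orient (inj₁ (refl , refl)) = inj₁ (row<rows , rows≤col)
      orient (inj₂ (refl , refl)) = inj₂ (row<rows , rows≤col)

    distinct⇒graceful : DistinctDiffs H ℓ → Graceful (biadjacency a)
    distinct⇒graceful distinct c _ _ (i , j) (i′ , j′) (box , one) (box′ , one′)
      with distinct (one⇒adj one) (one⇒adj one′)
             (trans (sym (boxValue≡diff i j)) (trans (trans box (sym box′)) (boxValue≡diff i′ j′)))
    ... | inj₁ (eqr , eqc) = cong₂ _,_ (Ordering.injective rowOrder eqr) (Ordering.injective colOrder eqc)
    -- Edges equal with their ends swapped would make a row vertex a column vertex.
    ... | inj₂ (eq , _)    = contradiction eq row≢col

    graceful⇒distinct : Graceful (biadjacency a) → DistinctDiffs H ℓ
    graceful⇒distinct graceful uv xy eq with adj⇒entry uv | adj⇒entry xy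
    ... | i , j , one , e | i′ , j′ , one′ , e′
      -- Equal differences put both entries on the same diagonal. Gracefulness identifies the
      -- positions, and both edges then join `row i` to `col j`; only their orientations remain to
      -- be compared.
      with refl ← graceful (boxValue i j) (boxValue≥1 i j) (boxValue≤p+q∸1 i j) (i , j) (i′ , j′)
                    (refl , one) (trans (boxValue≡diff′ e′) (trans (sym eq) (sym (boxValue≡diff′ e))) , one′)
      = combine e e′
      where
      combine : ∀ {u v x y r c : Fin N} → SameEdge u v r c → SameEdge x y r c → SameEdge u v x y
      combine (inj₁ (refl , refl)) (inj₁ (refl , refl)) = inj₁ (refl , refl)
      combine (inj₁ (refl , refl)) (inj₂ (refl , refl)) = inj₂ (refl , refl)
      combine (inj₂ (refl , refl)) (inj₁ (refl , refl)) = inj₂ (refl , refl)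
      combine (inj₂ (refl , refl)) (inj₂ (refl , refl)) = inj₁ (refl , refl)

    -- A 1 on each diagonal comes from `attains`, its uniqueness from `distinct`.
    attains⇒completelyGraceful : DistinctDiffs H ℓ → Attains H ℓ (rows + cols ∸ 1) →
                                 CompletelyGraceful (biadjacency a)
    attains⇒completelyGraceful distinct attains c 1≤c c≤ with attains c 1≤c c≤
    ... | u , v , uv , diff with adj⇒entry uv
    ... | i , j , one , e =
      (i , j) , on-c , λ {t} → distinct⇒graceful distinct c 1≤c c≤ (i , j) t on-c
      where
      on-c : OneOnDiagonal (biadjacency a) c (i , j)
      on-c = trans (boxValue≡diff′ e) diff , one

-- Bipartitions and arrangements given by a threshold

∈-tabulate⁺ : ∀ {b : Fin N → Bool} {v} → b v ≡ true → v ∈ tabulate b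
∈-tabulate⁺ {b = b} {v} eq = lookup⇒[]= v _ (trans (lookup∘tabulate b v) eq)

∈-tabulate⁻ : ∀ {b : Fin N → Bool} {v} → v ∈ tabulate b → b v ≡ true
∈-tabulate⁻ {b = b} {v} v∈ = trans (sym (lookup∘tabulate b v)) ([]=⇒lookup v∈)

below : (Fin N → ℕ) → ℕ → Subset N
below ℓ p = tabulate (λ v → ℓ v <ᵇ p)

module _ (ℓ : Fin N → ℕ) (p : ℕ) {v : Fin N} where

  ∈-below⁺ : ℓ v < p → v ∈ below ℓ p
  ∈-below⁺ ℓv<p = ∈-tabulate⁺ (Equivalence.to T-≡ (<⇒<ᵇ ℓv<p))

  ∈-below⁻ : v ∈ below ℓ p → ℓ v < p
  ∈-below⁻ v∈ = <ᵇ⇒< (ℓ v) p (Equivalence.from T-≡ (∈-tabulate⁻ {b = λ u → ℓ u <ᵇ p} v∈))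

  ∈-∁below⁺ : p ≤ ℓ v → v ∈ ∁ (below ℓ p)
  ∈-∁below⁺ p≤ℓv = x∉p⇒x∈∁p (λ v∈ → ≤⇒≯ p≤ℓv (∈-below⁻ v∈))

  ∈-∁below⁻ : v ∈ ∁ (below ℓ p) → p ≤ ℓ v
  ∈-∁below⁻ v∈ = ≮⇒≥ (λ ℓv<p → x∈∁p⇒x∉p v∈ (∈-below⁺ ℓv<p))

threshold : (H : Graph N) (ℓ : Fin N → ℕ) (p : ℕ) → Separates H ℓ p → Bipartition H
threshold H ℓ p separates = record
  { X        = below ℓ p
  ; crossing = λ uv → Sum.map (λ (u< , v≥) → ∈-below⁺ ℓ p u< , ∈-∁below⁺ ℓ p v≥)
                              (λ (v< , u≥) → ∈-∁below⁺ ℓ p u≥ , ∈-below⁺ ℓ p v<)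
                              (separates uv)
  }

module _ (H : Graph N) {p q : ℕ} (1≤p : 1 ≤ p) (π : Fin N ↔ Fin (p + q))
         (separates : Separates H (toℕ ∘ Inverse.to π) p) where

  private
    open Inverse π

    ℓ : Fin N → ℕ
    ℓ = toℕ ∘ to

    at-row : Fin p → Fin N
    at-row i = from (i ↑ˡ q)

    at-col : Fin q → Fin N
    at-col j = from (p ↑ʳ j)

    ℓ-row : ∀ i → ℓ (at-row i) ≡ toℕ i
    ℓ-row i = trans (cong toℕ (strictlyInverseˡ (i ↑ˡ q))) (toℕ-↑ˡ i q)

    ℓ-col : ∀ j → ℓ (at-col j) ≡ p + toℕ j
    ℓ-col j = trans (cong toℕ (strictlyInverseˡ (p ↑ʳ j))) (toℕ-↑ʳ p j)

    row-found : ∀ {v} → ℓ v < p → ∃ λ i → at-row i ≡ v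
    row-found {v} ℓv<p = fromℕ< ℓv<p , inverseʳ (toℕ-injective
      (trans (toℕ-↑ˡ _ q) (toℕ-fromℕ< ℓv<p)))

    col-found : ∀ {v} → p ≤ ℓ v → ∃ λ j → at-col j ≡ v
    col-found {v} p≤ℓv = reduce≥ (to v) p≤ℓv , inverseʳ (splitAt⁻¹-↑ʳ (splitAt-≥ p (to v) p≤ℓv))

  -- Since `π` is a bijection, reading it backwards along the first `p` and the last `q` labels
  -- exhausts the two sides of the threshold.
  sorted : Arrangement (threshold H ℓ p separates)
  sorted = record
    { rows     = p
    ; cols     = q
    ; rows≥1   = 1≤p
    ; rowOrder = record
      { at         = at-row
      ; injective  = λ {i} {i′} eq → toℕ-injective (trans (sym (ℓ-row i)) (trans (cong ℓ eq) (ℓ-row i′)))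
      ; enumerates = λ v → mk⇔ (row-found ∘ ∈-below⁻ ℓ p)
          (λ { (i , refl) → ∈-below⁺ ℓ p (subst (_< p) (sym (ℓ-row i)) (toℕ<n i)) })
      }
    ; colOrder = record
      { at         = at-col
      ; injective  = λ {j} {j′} eq → toℕ-injective
          (+-cancelˡ-≡ p _ _ (trans (sym (ℓ-col j)) (trans (cong ℓ eq) (ℓ-col j′))))
      ; enumerates = λ v → mk⇔ (col-found ∘ ∈-∁below⁻ ℓ p)
          (λ { (j , refl) → ∈-∁below⁺ ℓ p (subst (p ≤_) (sym (ℓ-col j)) (m≤m+n p _)) })
      }
    }

  sorted-follows : Follows sorted ℓ
  sorted-follows = record { on-row = ℓ-row ; on-col = ℓ-col }

-- Labelings versus matrices

-- Among negative k only -1 has a natural number as k + 1, and it would give zero rows.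
rows⇒critical : ∀ {p k} → 1 ≤ p → + p ≡ k +ᶻ + 1 → ∃ λ r → k ≡ + r × p ≡ suc r
rows⇒critical {k = + r}            1≤p eq = r , refl , trans (ℤ.+-injective eq) (+-comm r 1)
rows⇒critical {k = -[1+ zero ]}    1≤p eq = contradiction (sym (ℤ.+-injective eq)) (<⇒≢ 1≤p)
rows⇒critical {k = -[1+ suc _ ]}   1≤p ()

module _ {n} (G : Graph n) where

  private
    m = size G

  labeling⇒n≤m+1 : ∀ {f : Labeling G} → IsBetaLabeling G f → n ≤ m + 1
  labeling⇒n≤m+1 β = ≤-trans (injective⇒≤ (IsBetaLabeling.injective β)) (≤-reflexive (+-comm 1 m))

  alpha⇒separates : ∀ {k f} → IsAlphaLabeling G (+ k) f → Separates G (toℕ ∘ f) (suc k)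
  alpha⇒separates α uv = Sum.map order order (IsAlphaLabeling.critical α uv)
    where
    order : ∀ {x k y} → (+ x) ℤ.≤ (+ k) × (+ k) ℤ.< (+ y) → x < suc k × suc k ≤ y
    order (x≤k , k<y) = s≤s (ℤ.drop‿+≤+ x≤k) , ℤ.drop‿+<+ k<y

  -- The conclusion is complete gracefulness for every α-labeling, so that it serves both
  -- equivalences.
  alpha⇒matrix : ∀ {k f} → IsAlphaLabeling G k f →
    n ≤ m + 1 × Bipartite G ×
    (Σ[ B ∈ Bipartition (hat G) ] Σ[ a ∈ Arrangement B ]
      (CompletelyGraceful (biadjacency a) × + Arrangement.rows a ≡ k +ᶻ + 1))
  alpha⇒matrix { -[1+ _ ]} α with () ← IsAlphaLabeling.0≤k α
  alpha⇒matrix {+ k} {f} α =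
    n≤m+1 , threshold G ℓ (suc k) separates , threshold (hat G) ℓ̂ (suc k) separates^ , a ,
    attains⇒completelyGraceful a (sorted-follows (hat G) (s≤s z≤n) π separates^)
      (isolated-distinct⁺ G j ℓ̂ ℓ ℓ̂≡ℓ (IsBetaLabeling.distinct isBeta))
      -- As rows and columns together number m + 1, the diagonals run from 1 to m, exactly the range
      -- of the differences.
      (subst (Attains (hat G) ℓ̂) (sym (cong (_∸ 1) p+q≡1+m))
        (isolated-attains G j ℓ̂ ℓ ℓ̂≡ℓ (attains-all G isBeta))) ,
    cong +_ (+-comm 1 k)
    where
    open IsAlphaLabeling α

    n≤m+1 = labeling⇒n≤m+1 isBeta
    separates = alpha⇒separates α
    j = m + 1 ∸ n
    -- Of the m + 1 vertices of the hat graph, k + 1 become rows; `k ≤ m` makes the subtraction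
    -- exact.
    q = m ∸ k

    ℓ : Fin n → ℕ
    ℓ = toℕ ∘ f

    p+q≡1+m : suc k + q ≡ suc m
    p+q≡1+m = cong suc (m+[n∸m]≡n (ℤ.drop‿+≤+ k≤m))

    cast-f-injective : Injective _≡_ _≡_ (cast (sym p+q≡1+m) ∘ f)
    cast-f-injective {u} {v} eq = IsBetaLabeling.injective isBeta
      (toℕ-injective (trans (sym (toℕ-cast _ (f u))) (trans (cong toℕ eq) (toℕ-cast _ (f v)))))

    extension = extend j (cast (sym p+q≡1+m) ∘ f) cast-f-injective
      (trans (m+[n∸m]≡n n≤m+1) (trans (+-comm m 1) (sym p+q≡1+m)))

    π : Fin (n + j) ↔ Fin (suc k + q)
    π = proj₁ extension

    ℓ̂ : Fin (n + j) → ℕ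
    ℓ̂ = toℕ ∘ Inverse.to π

    ℓ̂≡ℓ : ∀ u → ℓ̂ (u ↑ˡ j) ≡ ℓ u
    ℓ̂≡ℓ u = trans (cong toℕ (proj₂ extension u)) (toℕ-cast _ (f u))

    separates^ : Separates (hat G) ℓ̂ (suc k)
    separates^ = isolated-separates⁺ G j ℓ̂ ℓ ℓ̂≡ℓ separates

    a : Arrangement (threshold (hat G) ℓ̂ (suc k) separates^)
    a = sorted (hat G) (s≤s z≤n) π separates^

  -- A vertex is labeled by its number in the arrangement, rows first. By `n ≤ m + 1` the hat graph
  -- has exactly m + 1 vertices, so these numbers range from 0 to m.
  matrix⇒alpha : ∀ {k} → n ≤ m + 1 → {B : Bipartition (hat G)} (a : Arrangement B) →
    Graceful (biadjacency a) → + Arrangement.rows a ≡ k +ᶻ + 1 → HasAlphaLabeling G k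
  matrix⇒alpha {k} n≤m+1 a graceful rows≡k+1
    with r , refl , rows≡1+r ← rows⇒critical {k = k} (Arrangement.rows≥1 a) rows≡k+1
    = f , record
    { isBeta = record
      { injective = λ {u} {v} eq → ↑ˡ-injective j u v (Injection.injective (↔⇒↣ ν) (toℕ-injective
          (trans (sym (toℕ-cast _ (Inverse.to ν (u ↑ˡ j))))
            (trans (cong toℕ eq) (toℕ-cast _ (Inverse.to ν (v ↑ˡ j)))))))
      ; distinct = isolated-distinct⁻ G j ℓ̂ ℓ ℓ̂≡ℓ (graceful⇒distinct a follows graceful)
      }
    ; 0≤k = +≤+ z≤n
    -- From `r + 1 = rows ≤ rows + cols = m + 1`.
    ; k≤m = +≤+ (s≤s⁻¹ (subst₂ _≤_ rows≡1+r rows+cols≡1+m (m≤m+n rows cols)))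
    ; critical = λ uv → Sum.map (order rows≡1+r) (order rows≡1+r)
        (isolated-separates⁻ G j ℓ̂ ℓ ℓ̂≡ℓ (follows⇒separates a follows) uv)
    }
    where
    open Arrangement a using (rows; cols)

    j = m + 1 ∸ n
    ν = numbering a
    follows = numbering-follows a

    rows+cols≡1+m : rows + cols ≡ suc m
    rows+cols≡1+m = trans (sym (↔⇒≡ ν)) (trans (m+[n∸m]≡n n≤m+1) (+-comm m 1))

    ℓ̂ : Fin (n + j) → ℕ
    ℓ̂ = toℕ ∘ Inverse.to ν

    f : Labeling G
    f u = cast rows+cols≡1+m (Inverse.to ν (u ↑ˡ j))

    ℓ : Fin n → ℕ
    ℓ = toℕ ∘ f

    ℓ̂≡ℓ : ∀ u → ℓ̂ (u ↑ˡ j) ≡ ℓ u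
    ℓ̂≡ℓ u = sym (toℕ-cast rows+cols≡1+m (Inverse.to ν (u ↑ˡ j)))

    order : ∀ {p r x y} → p ≡ suc r → x < p × p ≤ y → (+ x) ℤ.≤ (+ r) × (+ r) ℤ.< (+ y)
    order refl (x<p , p≤y) = +≤+ (s≤s⁻¹ x<p) , +<+ p≤y

theorem2p6 : ∀ (n : ℕ) (G : Graph n) (k : ℤ) →
    (HasAlphaLabeling G k ⇔
    (n ≤ size G + 1 × Bipartite G ×
    (Σ[ B ∈ Bipartition (hat G) ] Σ[ a ∈ Arrangement B ]
    (Graceful (biadjacency a) × + Arrangement.rows a ≡ k +ᶻ + 1))))
    ×
    (HasCompleteAlphaLabeling G k ⇔
    (n ≡ size G + 1 × Bipartite G ×
    (Σ[ B ∈ Bipartition (hat G) ] Σ[ a ∈ Arrangement B ]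
    (CompletelyGraceful (biadjacency a) × + Arrangement.rows a ≡ k +ᶻ + 1))))
theorem2p6 n G k = mk⇔ to from , mk⇔ complete-to complete-from
  where
  m = size G

  to = λ (_ , α) →
    let n≤m+1 , bip , B , a , complete , rows≡k+1 = alpha⇒matrix G α
    in n≤m+1 , bip , B , a , complete⇒graceful complete , rows≡k+1

  from = λ (n≤m+1 , _ , _ , a , graceful , rows≡k+1) → matrix⇒alpha G n≤m+1 a graceful rows≡k+1

  complete-to = λ (f , γ) →
    let open IsCompleteAlphaLabeling γ
        _ , matrix = alpha⇒matrix G isAlpha
    -- A bijection of `Fin n` with `Fin (suc m)` forces n = m + 1.
    in trans (↔⇒≡ (⤖⇒↔ (mk⤖ bijective))) (+-comm 1 m) , matrix

  complete-from = λ (n≡m+1 , _ , _ , a , complete , rows≡k+1) →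
    let f , α = matrix⇒alpha G (≤-reflexive n≡m+1) a (complete⇒graceful complete) rows≡k+1
        f-injective = IsBetaLabeling.injective (IsAlphaLabeling.isBeta α)
    -- With n = m + 1 the injective labeling is onto by counting.
    in f , record
      { isAlpha   = α
      ; bijective = injective⇒bijective f-injective (≤-reflexive (trans (+-comm 1 m) (sym n≡m+1)))
      }
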